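{- Let $\theta=\phi(D)$ be a delta operator with poweroids $x^{\{n\}}$, and let $\eta=\phi^{ -1}(D)$. Then for every integer $n\ge1$, $$x^{\{n\}}=\sum_{\nu=1}^n x^\nu\,\frac{D^\nu 0^{\{n\}}}{\nu!}=\sum_{\nu=1}^n x^\nu\,\frac{\eta^\nu 0^n}{\nu!}=e^{xD}\,0^{\{n\}}=e^{x\eta}\,0^n .$$
   Context: Work with polynomials in $x$ (real or complex coefficients); $D$ is differentiation. A delta operator is $\theta=\phi(D)$, where $\phi(t)=\sum_{\nu\ge1}k_\nu t^\nu$ is a formal power series with $k_1=1$; $\phi^{ -1}$ is its compositional inverse. The poweroids $x^{\{n\}}$, $n=0,1,2,\dots$, of $\theta$ are the unique polynomials with $x^{\{0\}}=1$, $\theta x^{\{n\}}=n\,x^{\{n-1\}}$ for $n\ge1$, and $x^{\{n\}}|_{x=0}=0$ for $n\ge1$. For a formal power series $f$, $f(D)\,0^{\{n\}}=\big(f(D_z)z^{\{n\}}\big)|_{z=0}$ and $f(D)\,0^n=\big(f(D_z)z^{n}\big)|_{z=0}$, where $D_z=d/dz$; in particular $\eta^\nu 0^n=\big(\phi^{ -1}(D_z)^\nu z^n\big)|_{z=0}$. In $e^{xD}0^{\{n\}}$ and $e^{x\eta}0^n$ the operators $D,\eta$ act on the variable $z$ (later set to $0$), $x$ is treated as a parameter, and the exponentials are expanded as power series. -}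

module Defs where

open import Level using (Level; _⊔_)
open import Algebra.Bundles using (CommutativeRing)
open import Algebra.Bundles.Raw using (RawRing)
open import Algebra.Apartness.Bundles using (HeytingField; HeytingCommutativeRing)
import Algebra.Definitions.RawSemiring as RawSemiringDefs
import Algebra.Properties.Ring as RingProperties
open import Data.Fin.Base using (toℕ)
open import Data.List.Base using (List; []; _∷_; map; length; foldr)
open import Data.Nat.Base as ℕ using (ℕ; zero; suc; NonZero; _∸_; _!)
open import Data.Nat.GeneralisedArithmetic using (fold)
open import Data.Nat.Properties using (_!≢0)
open import Data.Product.Base using (proj₁; proj₂)

-- Polynomials and formal power series over a coefficient structure A.  Only
-- the operations of A are used, so that the construction can be iterated:
-- rawRing below makes Polynomial (Polynomial.rawRing A) the polynomials in z
-- whose coefficients are polynomials in x.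
module Polynomial {c ℓ : Level} (A : RawRing c ℓ) where

  open RawRing A
  open RawSemiringDefs rawSemiring using (sum) renaming (_×_ to _·ℕ_) public

  -- Coefficients in order of increasing degree; trailing zeros are allowed
  -- and are ignored by _≈ₚ_.
  Poly : Set c
  Poly = List Carrier

  coeff : Poly → ℕ → Carrier
  coeff []      _       = 0#
  coeff (a ∷ p) zero    = a
  coeff (a ∷ p) (suc k) = coeff p k

  infix 4 _≈ₚ_
  _≈ₚ_ : Poly → Poly → Set ℓ
  p ≈ₚ q = ∀ k → coeff p k ≈ coeff q k

  infixl 6 _+ₚ_
  _+ₚ_ : Poly → Poly → Poly
  []      +ₚ q       = q
  (a ∷ p) +ₚ []      = a ∷ p
  (a ∷ p) +ₚ (b ∷ q) = (a + b) ∷ (p +ₚ q)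

  infixr 7 _·ₚ_
  _·ₚ_ : Carrier → Poly → Poly
  a ·ₚ p = map (a *_) p

  infixl 7 _*ₚ_
  _*ₚ_ : Poly → Poly → Poly
  []      *ₚ q = []
  (a ∷ p) *ₚ q = a ·ₚ q +ₚ (0# ∷ (p *ₚ q))

  const : Carrier → Poly
  const a = a ∷ []

  X : Poly
  X = 0# ∷ 1# ∷ []

  rawRing : RawRing c ℓ
  rawRing = record
    { Carrier = Poly
    ; _≈_     = _≈ₚ_
    ; _+_     = _+ₚ_
    ; _*_     = _*ₚ_
    ; -_      = map -_
    ; 0#      = []
    ; 1#      = const 1#
    }

  open RawSemiringDefs (RawRing.rawSemiring rawRing) public
    using () renaming (_×_ to _·ℕₚ_; _^_ to _^ₚ_; sum to sumₚ)

  ∑₁ : ℕ → (ℕ → Poly) → Poly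
  ∑₁ n f = sumₚ {n} (λ i → f (suc (toℕ i)))

  eval : Carrier → Poly → Carrier
  eval a = foldr (λ b v → b + a * v) 0#

  infix 8 _|₀
  _|₀ : Poly → Carrier
  p |₀ = eval 0# p

  diffFrom : ℕ → Poly → Poly
  diffFrom k []      = []
  diffFrom k (a ∷ p) = (k ·ℕ a) ∷ diffFrom (suc k) p

  D : Poly → Poly
  D []      = []
  D (a ∷ p) = diffFrom 1 p

  infixr 9 _^ᵒ_
  _^ᵒ_ : (Poly → Poly) → ℕ → (Poly → Poly)
  (T ^ᵒ ν) p = fold p T ν

  Series : Set c
  Series = ℕ → Carrier

  infix 4 _≈ₛ_
  _≈ₛ_ : Series → Series → Set ℓ
  f ≈ₛ g = ∀ k → f k ≈ g k

  infixl 7 _*ₛ_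
  _*ₛ_ : Series → Series → Series
  (f *ₛ g) n = sum {suc n} (λ i → f (toℕ i) * g (n ∸ toℕ i))

  1ₛ : Series
  1ₛ zero    = 1#
  1ₛ (suc _) = 0#

  tₛ : Series
  tₛ (suc zero) = 1#
  tₛ _          = 0#

  infixr 8 _^ₛ_
  _^ₛ_ : Series → ℕ → Series
  f ^ₛ zero  = 1ₛ
  f ^ₛ suc k = f *ₛ (f ^ₛ k)

  -- f(g(t)), for g without constant term: then g^k does not contribute to
  -- the coefficient of t^n when k > n.
  infixr 9 _∘ₛ_
  _∘ₛ_ : Series → Series → Series
  (f ∘ₛ g) n = sum {suc n} (λ k → f (toℕ k) * (g ^ₛ toℕ k) n)

  -- f(T) = ∑_{ν ≥ 0} f_ν T^ν, for a linear operator T which lowers the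
  -- degree.  T^ν p vanishes as soon as ν exceeds the degree of p, in
  -- particular for all ν ≥ length p, so cutting the sum there loses nothing.
  _⟨_⟩ : Series → (Poly → Poly) → (Poly → Poly)
  (f ⟨ T ⟩) p = sumₚ {length p} (λ i → f (toℕ i) ·ₚ (T ^ᵒ toℕ i) p)

  record IsDelta (φ : Series) : Set ℓ where
    field
      φ₀≈0 : φ 0 ≈ 0#
      φ₁≈1 : φ 1 ≈ 1#

  record IsCompositionalInverse (φ ψ : Series) : Set ℓ where
    field
      ψ₀≈0  : ψ 0 ≈ 0#
      φ∘ψ≈t : φ ∘ₛ ψ ≈ₛ tₛ
      ψ∘φ≈t : ψ ∘ₛ φ ≈ₛ tₛ

  record IsPoweroids (φ : Series) (p : ℕ → Poly) : Set ℓ where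
    field
      p₀≈1      : p 0 ≈ₚ const 1#
      θpₙ≈npₙ₋₁ : ∀ n → (φ ⟨ D ⟩) (p (suc n)) ≈ₚ suc n ·ℕₚ p n
      pₙ|₀≈0    : ∀ n → (p (suc n)) |₀ ≈ 0#

fieldRing : ∀ {c ℓ₁ ℓ₂} → HeytingField c ℓ₁ ℓ₂ → CommutativeRing c ℓ₁
fieldRing F = HeytingCommutativeRing.commutativeRing (HeytingField.heytingCommutativeRing F)

CharacteristicZero : ∀ {c ℓ₁ ℓ₂} → HeytingField c ℓ₁ ℓ₂ → Set ℓ₂
CharacteristicZero F = ∀ n → .{{NonZero n}} → (n ·ℕ 1#) # 0#
  where
  open HeytingField F using (_#_; 0#; 1#)
  open RawSemiringDefs (RawRing.rawSemiring (CommutativeRing.rawRing (fieldRing F))) using () renaming (_×_ to _·ℕ_)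

-- The real or complex numbers are replaced by an arbitrary (Heyting) field of
-- characteristic zero.
module Setting {c ℓ₁ ℓ₂} (F : HeytingField c ℓ₁ ℓ₂) (char0 : CharacteristicZero F) where

  open CommutativeRing (fieldRing F) using (Carrier; _≈_; _+_; _*_; -_; _-_; 0#; 1#)

  module K[x] = Polynomial (CommutativeRing.rawRing (fieldRing F))

  -- Polynomials in z and power series in t, with x as a parameter.
  module K[x][z] = Polynomial K[x].rawRing

  open K[x]

  -- HeytingField provides inverses of differences x - y with x # y; here y = 0.
  1/_! : ℕ → Carrier
  1/ ν ! = proj₁ (HeytingField.#⇒invertible F (char0 (ν !) {{ν !≢0}}))

  1/ν!-inverse : ∀ ν → ((ν !) ·ℕ 1#) * 1/ ν ! ≈ 1#
  1/ν!-inverse ν = trans (*-congʳ (sym x-0≈x))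
    (proj₂ (proj₂ (HeytingField.#⇒invertible F (char0 (ν !) {{ν !≢0}}))))
    where
    open CommutativeRing (fieldRing F)
      using (trans; sym; *-congʳ; +-congˡ; +-identityʳ; ring)
    open RingProperties ring using (-0#≈0#)
    x-0≈x : ∀ {x} → x - 0# ≈ x
    x-0≈x = trans (+-congˡ -0#≈0#) (+-identityʳ _)

  infixl 7 _/_!
  _/_! : Carrier → ℕ → Carrier
  a / ν ! = a * 1/ ν !

  -- A polynomial in z, or a series in t, over K regarded as one over K[x].
  liftPoly : Poly → K[x][z].Poly
  liftPoly = map const

  liftSeries : Series → K[x][z].Series
  liftSeries f ν = const (f ν)

  -- e^{xt} as a series in t with coefficients x^ν / ν! in K[x].
  e^xt : K[x][z].Series
  e^xt ν = X ^ₚ ν *ₚ const (1# / ν !)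

  -- e^{xD} q(z) and e^{xη} q(z) at z = 0, where η = ψ(D); the results are
  -- polynomials in x.
  e^xD_|₀ : Poly → Poly
  e^xD q |₀ = (e^xt K[x][z].⟨ K[x][z].D ⟩) (liftPoly q) K[x][z].|₀

  e^x[_⟨D⟩]_|₀ : K[x].Series → Poly → Poly
  e^x[ ψ ⟨D⟩] q |₀ = (e^xt K[x][z].⟨ η ⟩) (liftPoly q) K[x][z].|₀
    where
    η : K[x][z].Poly → K[x][z].Poly
    η = liftSeries ψ K[x][z].⟨ K[x][z].D ⟩

{-# OPTIONS --safe #-}

-- A polynomial p is determined by its Taylor sequence k ↦ (Dᵏ p)|₀, on which
-- D is the shift, and products of power series in D act as composites.  With
-- a n = x^{n} / n! we have θ (a (n+1)) = a n, so D = φ⁻¹(θ) gives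
-- D (a n) = ∑_{i ≤ n} φ⁻¹ᵢ (a (n - i)).  This is the recursion defining the
-- powers of φ⁻¹, whence (D^ν (a n))|₀ = [tⁿ] φ⁻¹(t)^ν = (η^ν xⁿ)|₀ / n!.  The
-- identities of the theorem then say that each polynomial in question has
-- (D^ν x^{n})|₀ / ν! as its coefficient of x^ν.
module Submission where

open import Defs
open import Level using (Level; _⊔_)
open import Algebra.Bundles using (CommutativeRing)
open import Algebra.Apartness.Bundles using (HeytingField)
import Algebra.Properties.CommutativeSemigroup as CommutativeSemigroupProperties
import Algebra.Properties.Semiring.Mult as SemiringMult
import Algebra.Properties.Semiring.Sum as SemiringSum
open import Data.Fin.Base using (toℕ)
open import Data.Fin.Properties using (toℕ<n)
open import Data.List.Base using ([]; _∷_; length; map)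
open import Data.List.Properties using (length-map)
open import Data.List.Relation.Binary.Pointwise.Base using (Pointwise; []; _∷_)
open import Data.List.Relation.Binary.Pointwise using (Pointwise-length)
open import Data.Nat.Base as ℕ using (ℕ; zero; suc; _≤_; _<_; z≤n; s≤s; _∸_; _!)
open import Data.Nat.Properties
  using (≤-refl; ≤-reflexive; ≤-trans; ≤-total; <⇒≢; m≤m+n; m≤n+m; m≤n⇒m≤1+n; n≤1+n; m∸n≤m;
         +-suc; suc-injective; +-∸-assoc)
import Data.Nat.Properties as ℕₚ
open import Data.Product.Base using (_×_; _,_)
open import Data.Sum.Base using (inj₁; inj₂)
open import Function.Base using (_∘_)
open import Relation.Binary.PropositionalEquality as ≡ using (_≡_; _≢_)
open import Relation.Nullary.Negation using (contradiction)
import Relation.Binary.Reasoning.Setoid as SetoidReasoning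

module _ {c ℓ : Level} (R : CommutativeRing c ℓ) where

  open CommutativeRing R hiding (zero)
  open Polynomial rawRing
  open SetoidReasoning setoid
  open SemiringSum semiring using
    (sum-cong-≋; ∑-distrib-+; ∑-comm; *-distribˡ-sum; *-distribʳ-sum)
  open SemiringMult semiring using (×-congʳ; ×-homo-1; ×-assocˡ; ×-comm-*)

  -- Finite sums and eventually vanishing sequences.

  VanishesFrom : ℕ → (ℕ → Carrier) → Set ℓ
  VanishesFrom n f = ∀ k → n ≤ k → f k ≈ 0#

  vanishes-mono : ∀ {m n f} → m ≤ n → VanishesFrom m f → VanishesFrom n f
  vanishes-mono m≤n v k n≤k = v k (≤-trans m≤n n≤k)

  -- Opaque so that the summand can be inferred from the sum.
  opaque
    ∑ : ℕ → (ℕ → Carrier) → Carrier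
    ∑ n f = sum {n} (λ i → f (toℕ i))

    sum≈∑ : ∀ n f → sum {n} (λ i → f (toℕ i)) ≈ ∑ n f
    sum≈∑ n f = refl

    ∑-empty : ∀ f → ∑ 0 f ≈ 0#
    ∑-empty f = refl

    ∑-suc : ∀ n f → ∑ (suc n) f ≈ f 0 + ∑ n (f ∘ suc)
    ∑-suc n f = refl

    ∑-cong : ∀ n {f g} → (∀ i → i < n → f i ≈ g i) → ∑ n f ≈ ∑ n g
    ∑-cong n f≈g = sum-cong-≋ (λ i → f≈g (toℕ i) (toℕ<n i))

    ∑-distrib : ∀ n f g → ∑ n (λ i → f i + g i) ≈ ∑ n f + ∑ n g
    ∑-distrib n f g = ∑-distrib-+ {n} (f ∘ toℕ) (g ∘ toℕ)

    *-distribˡ-∑ : ∀ n x f → x * ∑ n f ≈ ∑ n (λ i → x * f i)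
    *-distribˡ-∑ n x f = *-distribˡ-sum {n} x (f ∘ toℕ)

    *-distribʳ-∑ : ∀ n x f → ∑ n f * x ≈ ∑ n (λ i → f i * x)
    *-distribʳ-∑ n x f = *-distribʳ-sum {n} x (f ∘ toℕ)

    ∑-swap : ∀ m n (f : ℕ → ℕ → Carrier) →
             ∑ m (λ i → ∑ n (f i)) ≈ ∑ n (λ j → ∑ m (λ i → f i j))
    ∑-swap m n f = ∑-comm {m} {n} (λ i j → f (toℕ i) (toℕ j))

  *ₛ≈∑ : ∀ f g n → (f *ₛ g) n ≈ ∑ (suc n) (λ i → f i * g (n ∸ i))
  *ₛ≈∑ f g n = sum≈∑ (suc n) (λ i → f i * g (n ∸ i))

  ∘ₛ≈∑ : ∀ f g n → (f ∘ₛ g) n ≈ ∑ (suc n) (λ k → f k * (g ^ₛ k) n)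
  ∘ₛ≈∑ f g n = sum≈∑ (suc n) (λ k → f k * (g ^ₛ k) n)

  ∑-zero : ∀ n {f} → (∀ i → f i ≈ 0#) → ∑ n f ≈ 0#
  ∑-zero zero    f≈0 = ∑-empty _
  ∑-zero (suc n) f≈0 =
    trans (∑-suc n _) (trans (+-cong (f≈0 0) (∑-zero n (f≈0 ∘ suc))) (+-identityˡ _))

  ∑-truncate : ∀ {m n f} → m ≤ n → VanishesFrom m f → ∑ n f ≈ ∑ m f
  ∑-truncate {n = n} z≤n       v = trans (∑-zero n (λ i → v i z≤n)) (sym (∑-empty _))
  ∑-truncate         (s≤s m≤n) v = trans (∑-suc _ _) (trans
    (+-congˡ (∑-truncate m≤n (λ k m≤k → v (suc k) (s≤s m≤k)))) (sym (∑-suc _ _)))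

  -- Operators cut their series at the length of a list, which trailing zeros can make larger than
  -- the degree requires; this identifies the sums for any two admissible bounds.
  ∑-bound-irrelevant : ∀ {m n f} → VanishesFrom m f → VanishesFrom n f → ∑ m f ≈ ∑ n f
  ∑-bound-irrelevant {m} {n} vₘ vₙ with ≤-total m n
  ... | inj₁ m≤n = sym (∑-truncate m≤n vₘ)
  ... | inj₂ n≤m = ∑-truncate n≤m vₙ

  ∑-two : ∀ f → ∑ 2 f ≈ f 0 + f 1
  ∑-two f = trans (∑-suc 1 f) (+-congˡ
    (trans (∑-suc 0 (f ∘ suc)) (trans (+-congˡ (∑-empty _)) (+-identityʳ _))))

  ∑-single : ∀ {n j f} → j < n → (∀ i → i ≢ j → f i ≈ 0#) → ∑ n f ≈ f j
  ∑-single {suc n} {zero}  _         v = trans (∑-suc n _)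
    (trans (+-congˡ (∑-zero n (λ i → v (suc i) λ ()))) (+-identityʳ _))
  ∑-single {suc n} {suc j} (s≤s j<n) v = trans (∑-suc n _)
    (trans (+-cong (v 0 λ ()) (∑-single j<n λ i i≢j → v (suc i) (i≢j ∘ suc-injective)))
      (+-identityˡ _))

  -- Power series acting on sequences.

  -- The Taylor sequence s k = (Dᵏ p)|₀ turns f(D) into act N f, for any
  -- bound N beyond the degree of p.
  act : ℕ → Series → (ℕ → Carrier) → (ℕ → Carrier)
  act N f s k = ∑ N (λ i → f i * s (i ℕ.+ k))

  term-vanishes : ∀ {N s} (f : Series) k → VanishesFrom N s → VanishesFrom N (λ i → f i * s (i ℕ.+ k))
  term-vanishes f k v i N≤i = trans (*-congˡ (v _ (≤-trans N≤i (m≤m+n i k)))) (zeroʳ _)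

  act-bound-irrelevant : ∀ {M N s} f k → VanishesFrom M s → VanishesFrom N s →
                         act M f s k ≈ act N f s k
  act-bound-irrelevant f k vₘ vₙ =
    ∑-bound-irrelevant (term-vanishes f k vₘ) (term-vanishes f k vₙ)

  act-cong : ∀ N f {s s′} k → (∀ i → s i ≈ s′ i) → act N f s k ≈ act N f s′ k
  act-cong N f k s≈s′ = ∑-cong N (λ i _ → *-congˡ (s≈s′ _))

  act-vanishes : ∀ {M s} N f → VanishesFrom M s → VanishesFrom M (act N f s)
  act-vanishes N f v k M≤k =
    ∑-zero N (λ i → trans (*-congˡ (v _ (≤-trans M≤k (m≤n+m k i)))) (zeroʳ _))

  -- The series t f(t).
  delay : Series → Series
  delay f zero    = 0#
  delay f (suc k) = f k

  -- Splits off the constant term, f = f₀ + t f⁺, which gives products a recursive form suited to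
  -- induction.
  *ₛ-head : ∀ f g m → (f *ₛ g) m ≈ f 0 * g m + delay ((f ∘ suc) *ₛ g) m
  *ₛ-head f g zero    = refl
  *ₛ-head f g (suc m) = refl

  -- Induction on the bound through f = f₀ + t f⁺: the factor t becomes the shift of s, and the
  -- shifted sequence vanishes one index earlier, so the bound drops by one.
  act-*ₛ : ∀ {N s} f g k → VanishesFrom N s → act N (f *ₛ g) s k ≈ act N f (act N g s) k
  act-*ₛ {zero}      f g k v = trans (∑-empty _) (sym (∑-empty _))
  act-*ₛ {suc N} {s} f g k v = begin
    ∑ (suc N) (λ m → (f *ₛ g) m * s (m ℕ.+ k))
      ≈⟨ ∑-cong (suc N) (λ m _ → trans (*-congʳ (*ₛ-head f g m))
           (trans (distribʳ _ _ _) (+-congʳ (*-assoc _ _ _)))) ⟩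
    ∑ (suc N) (λ m → f 0 * (g m * s (m ℕ.+ k)) + delay fg m * s (m ℕ.+ k))
      ≈⟨ ∑-distrib (suc N) _ _ ⟩
    ∑ (suc N) (λ m → f 0 * (g m * s (m ℕ.+ k))) + ∑ (suc N) (λ m → delay fg m * s (m ℕ.+ k))
      -- The term m = 0 of the second sum vanishes by `delay`; the others, reindexed, act on the
      -- shifted sequence.
      ≈⟨ +-cong (sym (*-distribˡ-∑ (suc N) _ _))
           (trans (∑-suc N _) (trans (+-congʳ (zeroˡ _)) (+-identityˡ _))) ⟩
    f 0 * act (suc N) g s k + act N fg s⁺ k
      ≈⟨ +-congˡ (act-*ₛ (f ∘ suc) g k v⁺) ⟩
    f 0 * act (suc N) g s k + act N (f ∘ suc) (act N g s⁺) k
      ≈⟨ +-congˡ (act-cong N (f ∘ suc) k act-suc) ⟩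
    f 0 * act (suc N) g s k + ∑ N (λ i → f (suc i) * act (suc N) g s (suc i ℕ.+ k))
      ≈⟨ ∑-suc N _ ⟨
    act (suc N) f (act (suc N) g s) k ∎
    where
    fg = (f ∘ suc) *ₛ g
    s⁺ = s ∘ suc
    v⁺ : VanishesFrom N s⁺
    v⁺ j N≤j = v (suc j) (s≤s N≤j)
    act-suc : ∀ j → act N g s⁺ j ≈ act (suc N) g s (suc j)
    act-suc j = begin
      ∑ N (λ i → g i * s (suc i ℕ.+ j))
        ≈⟨ ∑-cong N (λ i _ → *-congˡ (reflexive (≡.cong s (≡.sym (+-suc i j))))) ⟩
      ∑ N (λ i → g i * s (i ℕ.+ suc j))
        -- In the added term i = N the index N + suc j is already past the vanishing bound of s.
        ≈⟨ ∑-bound-irrelevant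
             (λ i N≤i → trans (*-congˡ (v _ (≤-trans (s≤s N≤i)
               (≤-trans (s≤s (m≤m+n i j)) (≤-reflexive (≡.sym (+-suc i j))))))) (zeroʳ _))
             (term-vanishes g (suc j) v) ⟩
      ∑ (suc N) (λ i → g i * s (i ℕ.+ suc j)) ∎

  act-1ₛ : ∀ N s k → act (suc N) 1ₛ s k ≈ s k
  act-1ₛ N s k = trans (∑-suc N _) (trans (+-cong (*-identityˡ _) (∑-zero N (λ i → zeroˡ _))) (+-identityʳ _))

  act-tₛ : ∀ {N s} k → VanishesFrom N s → act N tₛ s k ≈ s (suc k)
  act-tₛ {N} {s} k v = begin
    -- `N` may be smaller than 2; the sum then gains vanishing terms instead of losing them.
    act N tₛ s k                       ≈⟨ ∑-bound-irrelevant (term-vanishes tₛ k v) tₛ-short ⟩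
    ∑ 2 (λ i → tₛ i * s (i ℕ.+ k))     ≈⟨ ∑-two _ ⟩
    0# * s k + 1# * s (suc k)          ≈⟨ +-cong (zeroˡ _) (*-identityˡ _) ⟩
    0# + s (suc k)                     ≈⟨ +-identityˡ _ ⟩
    s (suc k)                          ∎
    where
    tₛ-short : VanishesFrom 2 (λ i → tₛ i * s (i ℕ.+ k))
    tₛ-short (suc (suc i)) _ = zeroˡ _
    tₛ-short (suc zero) (s≤s ())

  -- Since φ₀ = 0 and φ₁ = 1, the (m+1)-st Taylor coefficient of p survives
  -- in the m-th one of φ(D) p once all later ones vanish.
  act-delta-degree : ∀ {φ N s n} → IsDelta φ → VanishesFrom N s →
                     VanishesFrom n (act N φ s) → VanishesFrom (suc n) s
  act-delta-degree {φ} {N} {s} {n} δ v w = descend N (vanishes-mono (m≤n+m N (suc n)) v)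
    where
    open IsDelta δ
    top : ∀ m → n ≤ m → VanishesFrom (suc (suc m)) s → s (suc m) ≈ 0#
    top m n≤m u = begin
      s (suc m)                                ≈⟨ +-identityˡ _ ⟨
      0# + s (suc m)
        ≈⟨ +-cong (trans (*-congʳ φ₀≈0) (zeroˡ _))
             (trans (*-congʳ φ₁≈1) (*-identityˡ _)) ⟨
      φ 0 * s m + φ 1 * s (suc m)
        ≈⟨ ∑-two _ ⟨
      ∑ 2 (λ i → φ i * s (i ℕ.+ m))
        ≈⟨ ∑-bound-irrelevant late (term-vanishes φ m v) ⟩
      act N φ s m                              ≈⟨ w m n≤m ⟩
      0#                                       ∎
      where
      late : VanishesFrom 2 (λ i → φ i * s (i ℕ.+ m))
      late (suc (suc i)) _ = trans (*-congˡ (u _ (s≤s (s≤s (m≤n+m m i))))) (zeroʳ _)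
      late (suc zero) (s≤s ())
    -- Starting from the bound `suc n ℕ.+ N`, which is certainly large enough, the highest remaining
    -- index is removed one at a time by `top`.
    descend : ∀ d → VanishesFrom (suc n ℕ.+ d) s → VanishesFrom (suc n) s
    descend zero    u k n<k = u k (≤-trans (≤-reflexive (≡.cong suc (ℕₚ.+-identityʳ n))) n<k)
    descend (suc d) u = descend d u′
      where
      u″ : VanishesFrom (suc (suc (n ℕ.+ d))) s
      u″ = vanishes-mono (≤-reflexive (≡.cong suc (+-suc n d))) u
      u′ : VanishesFrom (suc n ℕ.+ d) s
      u′ (suc k) (s≤s n+d≤k) =
        top k (≤-trans (m≤m+n n d) n+d≤k) (vanishes-mono (s≤s (s≤s n+d≤k)) u″)

  -- Since φ = t φ⁺, every factor adds at least one to the order in t.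
  ^ₛ-order : ∀ {φ} → φ 0 ≈ 0# → ∀ k m → m < k → (φ ^ₛ k) m ≈ 0#
  ^ₛ-order {φ} φ₀≈0 (suc k) m (s≤s m≤k) = begin
    (φ *ₛ φ ^ₛ k) m                           ≈⟨ *ₛ-head φ (φ ^ₛ k) m ⟩
    φ 0 * (φ ^ₛ k) m + delay (φ⁺ *ₛ φ ^ₛ k) m ≈⟨ +-cong (trans (*-congʳ φ₀≈0) (zeroˡ _)) (tail m m≤k) ⟩
    0# + 0#                                   ≈⟨ +-identityˡ _ ⟩
    0#                                        ∎
    where
    φ⁺ = φ ∘ suc
    tail : ∀ m → m ≤ k → delay (φ⁺ *ₛ φ ^ₛ k) m ≈ 0#
    tail zero    _   = refl
    tail (suc m) m<k = trans (*ₛ≈∑ φ⁺ (φ ^ₛ k) m) (∑-zero (suc m) (λ i →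
      trans (*-congˡ (^ₛ-order φ₀≈0 k (m ∸ i) (≤-trans (s≤s (m∸n≤m m i)) m<k))) (zeroʳ _)))

  -- Taylor sequences of normalised poweroids as coefficients of powers of the inverse series.

  -- a n stands for the Taylor sequence of x^{n} / n!.
  module _ {φ ψ : Series} (φ₀≈0 : φ 0 ≈ 0#) (ψ∘φ≈t : ψ ∘ₛ φ ≈ₛ tₛ)
           (a : ℕ → ℕ → Carrier)
           (a-vanishes : ∀ n → VanishesFrom (suc n) (a n))
           (a-initial : ∀ n → a n 0 ≈ 1ₛ n)
           (φa≈a : ∀ n k → act (suc (suc n)) φ (a (suc n)) k ≈ a n k) where

    -- By `act-*ₛ` the power `φ ^ₛ i` acts as the i-fold iterate of θ, and each θ lowers the index
    -- of `a` by one.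
    φⁱa≈a : ∀ {n} i k → i ≤ n → act (suc n) (φ ^ₛ i) (a n) k ≈ a (n ∸ i) k
    φⁱa≈a {n}     zero    k _         = act-1ₛ n (a n) k
    φⁱa≈a {suc n} (suc i) k (s≤s i≤n) = begin
      act (suc (suc n)) (φ ^ₛ suc i) (a (suc n)) k
        ≈⟨ act-*ₛ φ (φ ^ₛ i) k (a-vanishes (suc n)) ⟩
      act (suc (suc n)) φ (act (suc (suc n)) (φ ^ₛ i) (a (suc n))) k
        ≈⟨ act-cong (suc (suc n)) φ k (λ j → φⁱa≈a i j (m≤n⇒m≤1+n i≤n)) ⟩
      act (suc (suc n)) φ (a (suc n ∸ i)) k
        ≡⟨ ≡.cong (λ m → act (suc (suc n)) φ (a m) k) (+-∸-assoc 1 i≤n) ⟩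
      act (suc (suc n)) φ (a (suc (n ∸ i))) k
        ≈⟨ act-bound-irrelevant φ k
             (vanishes-mono (s≤s (s≤s (m∸n≤m n i))) (a-vanishes (suc (n ∸ i))))
             (a-vanishes (suc (n ∸ i))) ⟩
      act (suc (suc (n ∸ i))) φ (a (suc (n ∸ i))) k
        ≈⟨ φa≈a (n ∸ i) k ⟩
      a (n ∸ i) k ∎

    -- D = ψ(θ), applied to a n.
    a-suc : ∀ n ν → a n (suc ν) ≈ ∑ (suc n) (λ i → ψ i * a (n ∸ i) ν)
    a-suc n ν = begin
      a n (suc ν)
        ≈⟨ act-tₛ ν (a-vanishes n) ⟨
      ∑ N (λ m → tₛ m * a n (m ℕ.+ ν))
        ≈⟨ ∑-cong N (λ m m<N → *-congʳ (ψ∘φ-coefficient m m<N)) ⟩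
      ∑ N (λ m → ∑ N (λ i → ψ i * (φ ^ₛ i) m) * a n (m ℕ.+ ν))
        ≈⟨ ∑-cong N (λ m _ → trans (*-distribʳ-∑ N _ _) (∑-cong N (λ i _ → *-assoc _ _ _))) ⟩
      ∑ N (λ m → ∑ N (λ i → ψ i * ((φ ^ₛ i) m * a n (m ℕ.+ ν))))
        ≈⟨ ∑-swap N N _ ⟩
      ∑ N (λ i → ∑ N (λ m → ψ i * ((φ ^ₛ i) m * a n (m ℕ.+ ν))))
        -- After the exchange of sums the inner one is `φ ^ₛ i` acting on `a n`.
        ≈⟨ ∑-cong N (λ { i (s≤s i≤n) → trans (sym (*-distribˡ-∑ N _ _)) (*-congˡ (φⁱa≈a i ν i≤n)) }) ⟩
      ∑ N (λ i → ψ i * a (n ∸ i) ν) ∎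
      where
      N = suc n
      high : ∀ m → VanishesFrom (suc m) (λ i → ψ i * (φ ^ₛ i) m)
      high m i m<i = trans (*-congˡ (^ₛ-order φ₀≈0 i m m<i)) (zeroʳ _)
      -- `_∘ₛ_` cuts the coefficient of t^m at `suc m` terms; the common bound `N` is reached by
      -- adding terms with i > m, where φⁱ has no coefficient at m.
      ψ∘φ-coefficient : ∀ m → m < N → tₛ m ≈ ∑ N (λ i → ψ i * (φ ^ₛ i) m)
      ψ∘φ-coefficient m m<N =
        trans (sym (ψ∘φ≈t m)) (trans (∘ₛ≈∑ ψ φ m) (sym (∑-truncate m<N (high m))))

    -- Induction on ν for all n at once: with the induction hypothesis inserted, `a-suc` becomes the
    -- convolution of ψ with `ψ ^ₛ ν`.
    a≈ψ^ : ∀ ν n → a n ν ≈ (ψ ^ₛ ν) n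
    a≈ψ^ zero    n = a-initial n
    a≈ψ^ (suc ν) n =
      trans (a-suc n ν) (trans (∑-cong (suc n) (λ i _ → *-congˡ (a≈ψ^ ν (n ∸ i)))) (sym (*ₛ≈∑ ψ (ψ ^ₛ ν) n)))


  -- Coefficients of polynomials and powers of the variable.

  coeff-+ₚ : ∀ p q k → coeff (p +ₚ q) k ≈ coeff p k + coeff q k
  coeff-+ₚ []      q       k       = sym (+-identityˡ _)
  coeff-+ₚ (a ∷ p) []      k       = sym (+-identityʳ _)
  coeff-+ₚ (a ∷ p) (b ∷ q) zero    = refl
  coeff-+ₚ (a ∷ p) (b ∷ q) (suc k) = coeff-+ₚ p q k

  coeff-·ₚ : ∀ a p k → coeff (a ·ₚ p) k ≈ a * coeff p k
  coeff-·ₚ a []      k       = sym (zeroʳ a)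
  coeff-·ₚ a (b ∷ p) zero    = refl
  coeff-·ₚ a (b ∷ p) (suc k) = coeff-·ₚ a p k

  coeff-·ℕₚ : ∀ n p k → coeff (n ·ℕₚ p) k ≈ n ·ℕ coeff p k
  coeff-·ℕₚ zero    p k = refl
  coeff-·ℕₚ (suc n) p k = trans (coeff-+ₚ p _ k) (+-congˡ (coeff-·ℕₚ n p k))

  coeff-sumₚ : ∀ n (f : ℕ → Poly) k → coeff (sumₚ {n} (λ i → f (toℕ i))) k ≈ ∑ n (λ i → coeff (f i) k)
  coeff-sumₚ zero    f k = sym (∑-empty _)
  coeff-sumₚ (suc n) f k = trans (coeff-+ₚ (f 0) _ k)
    (trans (+-congˡ (coeff-sumₚ n (f ∘ suc) k)) (sym (∑-suc n _)))

  coeff-beyond-length : ∀ p → VanishesFrom (length p) (coeff p)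
  coeff-beyond-length []      k       _         = refl
  coeff-beyond-length (a ∷ p) (suc k) (s≤s p≤k) = coeff-beyond-length p k p≤k

  |₀≈coeff : ∀ p → p |₀ ≈ coeff p 0
  |₀≈coeff []      = refl
  |₀≈coeff (a ∷ p) = trans (+-congˡ (zeroˡ _)) (+-identityʳ a)

  coeff-0∷[] : ∀ k → coeff (const 0#) k ≈ 0#
  coeff-0∷[] zero    = refl
  coeff-0∷[] (suc k) = refl

  coeff-X*ₚ : ∀ p k → coeff (X *ₚ p) k ≈ delay (coeff p) k
  coeff-X*ₚ p k = begin
    coeff (X *ₚ p) k
      -- The product unfolds to `0# ·ₚ p` plus the shift of `1# ·ₚ p +ₚ const 0#`, whose last
      -- summand comes from the empty tail of `X`.
      ≈⟨ coeff-+ₚ (0# ·ₚ p) _ k ⟩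
    coeff (0# ·ₚ p) k + coeff (0# ∷ (1# ·ₚ p +ₚ const 0#)) k
      ≈⟨ +-cong (trans (coeff-·ₚ 0# p k) (zeroˡ _)) (shifted k) ⟩
    0# + delay (coeff p) k
      ≈⟨ +-identityˡ _ ⟩
    delay (coeff p) k ∎
    where
    shifted : ∀ k → coeff (0# ∷ (1# ·ₚ p +ₚ const 0#)) k ≈ delay (coeff p) k
    shifted zero    = refl
    shifted (suc k) = trans (coeff-+ₚ (1# ·ₚ p) (const 0#) k)
      (trans (+-cong (trans (coeff-·ₚ 1# p k) (*-identityˡ _)) (coeff-0∷[] k)) (+-identityʳ _))

  coeff-X^-diagonal : ∀ n → coeff (X ^ₚ n) n ≈ 1#
  coeff-X^-diagonal zero    = refl
  coeff-X^-diagonal (suc n) = trans (coeff-X*ₚ (X ^ₚ n) (suc n)) (coeff-X^-diagonal n)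

  coeff-X^-off-diagonal : ∀ n k → n ≢ k → coeff (X ^ₚ n) k ≈ 0#
  coeff-X^-off-diagonal zero    zero    n≢k = contradiction ≡.refl n≢k
  coeff-X^-off-diagonal zero    (suc k) n≢k = refl
  coeff-X^-off-diagonal (suc n) zero    n≢k = coeff-X*ₚ (X ^ₚ n) 0
  coeff-X^-off-diagonal (suc n) (suc k) n≢k =
    trans (coeff-X*ₚ (X ^ₚ n) (suc k)) (coeff-X^-off-diagonal n k (n≢k ∘ ≡.cong suc))

  length-+ₚˡ : ∀ p q → length p ≤ length (p +ₚ q)
  length-+ₚˡ []      q       = z≤n
  length-+ₚˡ (a ∷ p) []      = ≤-refl
  length-+ₚˡ (a ∷ p) (b ∷ q) = s≤s (length-+ₚˡ p q)

  length-+ₚʳ : ∀ p q → length q ≤ length (p +ₚ q)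
  length-+ₚʳ []      q       = ≤-refl
  length-+ₚʳ (a ∷ p) []      = z≤n
  length-+ₚʳ (a ∷ p) (b ∷ q) = s≤s (length-+ₚʳ p q)

  -- Needed for e^{xη} 0ⁿ, whose series is cut at the length of `X ^ₚ n`: that length must leave
  -- room for all ν up to n.
  length-X^ : ∀ n → suc n ≤ length (X ^ₚ n)
  length-X^ zero    = ≤-refl
  length-X^ (suc n) = ≤-trans
    (s≤s (≤-trans (length-X^ n)
      (≤-trans (≤-reflexive (≡.sym (length-map (1# *_) (X ^ₚ n))))
               (length-+ₚˡ (1# ·ₚ X ^ₚ n) (const 0#)))))
    (length-+ₚʳ (0# ·ₚ X ^ₚ n) _)

  coeff-*ₚ-const : ∀ p b k → coeff (p *ₚ const b) k ≈ coeff p k * b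
  coeff-*ₚ-const []      b k       = sym (zeroˡ b)
  coeff-*ₚ-const (a ∷ p) b zero    = +-identityʳ _
  coeff-*ₚ-const (a ∷ p) b (suc k) = coeff-*ₚ-const p b k

  coeff-*ₚ-[] : ∀ p k → coeff (p *ₚ []) k ≈ 0#
  coeff-*ₚ-[] []      k       = refl
  coeff-*ₚ-[] (a ∷ p) zero    = refl
  coeff-*ₚ-[] (a ∷ p) (suc k) = coeff-*ₚ-[] p k

  -- Differentiation and Taylor sequences.

  ·ℕ-zeroʳ : ∀ n {x} → x ≈ 0# → n ·ℕ x ≈ 0#
  ·ℕ-zeroʳ zero    x≈0 = refl
  ·ℕ-zeroʳ (suc n) x≈0 = trans (+-cong x≈0 (·ℕ-zeroʳ n x≈0)) (+-identityˡ 0#)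

  coeff-diffFrom : ∀ j p k → coeff (diffFrom j p) k ≈ (k ℕ.+ j) ·ℕ coeff p k
  coeff-diffFrom j []      k       = sym (·ℕ-zeroʳ (k ℕ.+ j) refl)
  coeff-diffFrom j (a ∷ p) zero    = refl
  coeff-diffFrom j (a ∷ p) (suc k) =
    trans (coeff-diffFrom (suc j) p k) (reflexive (≡.cong (_·ℕ coeff p k) (+-suc k j)))

  coeff-D : ∀ p k → coeff (D p) k ≈ suc k ·ℕ coeff p (suc k)
  coeff-D []      k = sym (·ℕ-zeroʳ (suc k) refl)
  coeff-D (a ∷ p) k =
    trans (coeff-diffFrom 1 p k) (reflexive (≡.cong (_·ℕ coeff p k) (ℕₚ.+-comm k 1)))

  -- The factor k! makes this the value of Dᵏ p at 0, by `D^|₀≈taylor`, and turns D into a plain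
  -- shift.
  taylor : Poly → ℕ → Carrier
  taylor p k = (k !) ·ℕ coeff p k

  taylor-vanishes : ∀ {N} p → VanishesFrom N (coeff p) → VanishesFrom N (taylor p)
  taylor-vanishes p v k N≤k = ·ℕ-zeroʳ (k !) (v k N≤k)

  taylor-beyond-length : ∀ p → VanishesFrom (length p) (taylor p)
  taylor-beyond-length p = taylor-vanishes p (coeff-beyond-length p)

  taylor-0 : ∀ p → taylor p 0 ≈ p |₀
  taylor-0 p = trans (×-homo-1 _) (sym (|₀≈coeff p))

  taylor-cong : ∀ p q → p ≈ₚ q → ∀ k → taylor p k ≈ taylor q k
  taylor-cong p q p≈q k = ×-congʳ (k !) (p≈q k)

  taylor-·ℕₚ : ∀ n p k → taylor (n ·ℕₚ p) k ≈ n ·ℕ taylor p k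
  taylor-·ℕₚ n p k = begin
    (k !) ·ℕ coeff (n ·ℕₚ p) k     ≈⟨ ×-congʳ (k !) (coeff-·ℕₚ n p k) ⟩
    (k !) ·ℕ (n ·ℕ coeff p k)      ≈⟨ ×-assocˡ _ (k !) n ⟩
    (k ! ℕ.* n) ·ℕ coeff p k       ≡⟨ ≡.cong (_·ℕ coeff p k) (ℕₚ.*-comm (k !) n) ⟩
    (n ℕ.* k !) ·ℕ coeff p k       ≈⟨ ×-assocˡ _ n (k !) ⟨
    n ·ℕ ((k !) ·ℕ coeff p k)      ∎

  taylor-D : ∀ p k → taylor (D p) k ≈ taylor p (suc k)
  taylor-D p k = begin
    (k !) ·ℕ coeff (D p) k                   ≈⟨ ×-congʳ (k !) (coeff-D p k) ⟩
    (k !) ·ℕ (suc k ·ℕ coeff p (suc k))      ≈⟨ ×-assocˡ _ (k !) (suc k) ⟩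
    (k ! ℕ.* suc k) ·ℕ coeff p (suc k)       ≡⟨ ≡.cong (_·ℕ coeff p (suc k)) (ℕₚ.*-comm (k !) (suc k)) ⟩
    (suc k !) ·ℕ coeff p (suc k)             ∎

  taylor-D^ : ∀ i p k → taylor ((D ^ᵒ i) p) k ≈ taylor p (i ℕ.+ k)
  taylor-D^ zero    p k = refl
  taylor-D^ (suc i) p k = trans (taylor-D ((D ^ᵒ i) p) k)
    (trans (taylor-D^ i p (suc k)) (reflexive (≡.cong (taylor p) (+-suc i k))))

  D^|₀≈taylor : ∀ p ν → (D ^ᵒ ν) p |₀ ≈ taylor p ν
  D^|₀≈taylor p ν = trans (sym (taylor-0 ((D ^ᵒ ν) p)))
    (trans (taylor-D^ ν p 0) (reflexive (≡.cong (taylor p) (ℕₚ.+-identityʳ ν))))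

  -- Dⁱ shifts the Taylor sequence by i, and the bound of `act` is the cut made by `_⟨_⟩`.
  taylor-⟨D⟩ : ∀ f p k → taylor ((f ⟨ D ⟩) p) k ≈ act (length p) f (taylor p) k
  taylor-⟨D⟩ f p k = begin
    (k !) ·ℕ coeff ((f ⟨ D ⟩) p) k
      ≈⟨ ×-congʳ (k !) (coeff-sumₚ (length p) (λ i → f i ·ₚ (D ^ᵒ i) p) k) ⟩
    (k !) ·ℕ ∑ (length p) (λ i → coeff (f i ·ₚ (D ^ᵒ i) p) k)
      ≈⟨ ·ℕ-∑ (k !) (length p) ⟩
    ∑ (length p) (λ i → (k !) ·ℕ coeff (f i ·ₚ (D ^ᵒ i) p) k)
      ≈⟨ ∑-cong (length p) (λ i _ → trans (×-congʳ (k !) (coeff-·ₚ (f i) ((D ^ᵒ i) p) k))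
           (trans (sym (×-comm-* (k !) _ _)) (*-congˡ (taylor-D^ i p k)))) ⟩
    act (length p) f (taylor p) k ∎
    where
    ·ℕ-∑ : ∀ m n {g} → m ·ℕ ∑ n g ≈ ∑ n (λ i → m ·ℕ g i)
    ·ℕ-∑ zero    n = sym (∑-zero n (λ _ → refl))
    ·ℕ-∑ (suc m) n = trans (+-congˡ (·ℕ-∑ m n)) (sym (∑-distrib n _ _))

  -- Iteration of the operator becomes a power of the series by `act-*ₛ`. The bound `suc N` keeps
  -- the constant term of `ψ ^ₛ 0` inside the sum, as `act-1ₛ` requires.
  taylor-⟨D⟩^ : ∀ {N} ψ p ν k → VanishesFrom N (taylor p) →
                taylor (((ψ ⟨ D ⟩) ^ᵒ ν) p) k ≈ act (suc N) (ψ ^ₛ ν) (taylor p) k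
  taylor-⟨D⟩^ {N} ψ p zero    k v = sym (act-1ₛ N (taylor p) k)
  taylor-⟨D⟩^ {N} ψ p (suc ν) k v = begin
    taylor ((ψ ⟨ D ⟩) q) k
      ≈⟨ taylor-⟨D⟩ ψ q k ⟩
    act (length q) ψ (taylor q) k
      -- The length of the list `q` need not be `suc N`, but the Taylor sequence of `q` vanishes
      -- from either bound on.
      ≈⟨ act-bound-irrelevant ψ k (taylor-beyond-length q) q-vanishes ⟩
    act (suc N) ψ (taylor q) k
      ≈⟨ act-cong (suc N) ψ k IH ⟩
    act (suc N) ψ (act (suc N) (ψ ^ₛ ν) (taylor p)) k
      ≈⟨ act-*ₛ ψ (ψ ^ₛ ν) k v⁺ ⟨
    act (suc N) (ψ ^ₛ suc ν) (taylor p) k ∎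
    where
    q = ((ψ ⟨ D ⟩) ^ᵒ ν) p
    v⁺ : VanishesFrom (suc N) (taylor p)
    v⁺ = vanishes-mono (n≤1+n N) v
    IH : ∀ j → taylor q j ≈ act (suc N) (ψ ^ₛ ν) (taylor p) j
    IH j = taylor-⟨D⟩^ ψ p ν j v
    q-vanishes : VanishesFrom (suc N) (taylor q)
    q-vanishes j N<j = trans (IH j) (act-vanishes (suc N) (ψ ^ₛ ν) v⁺ j N<j)

  X^-vanishes : ∀ n → VanishesFrom (suc n) (taylor (X ^ₚ n))
  X^-vanishes n = taylor-vanishes (X ^ₚ n) (λ k n<k → coeff-X^-off-diagonal n k (<⇒≢ n<k))

  -- The Taylor sequence of xⁿ is n! at index n and zero elsewhere, so it singles out the
  -- coefficient of tⁿ in ψ(t)^ν.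
  ⟨D⟩^X^|₀ : ∀ ψ n ν → ((ψ ⟨ D ⟩) ^ᵒ ν) (X ^ₚ n) |₀ ≈ (ψ ^ₛ ν) n * ((n !) ·ℕ 1#)
  ⟨D⟩^X^|₀ ψ n ν = begin
    ((ψ ⟨ D ⟩) ^ᵒ ν) (X ^ₚ n) |₀
      ≈⟨ taylor-0 (((ψ ⟨ D ⟩) ^ᵒ ν) (X ^ₚ n)) ⟨
    taylor (((ψ ⟨ D ⟩) ^ᵒ ν) (X ^ₚ n)) 0
      ≈⟨ taylor-⟨D⟩^ ψ (X ^ₚ n) ν 0 (X^-vanishes n) ⟩
    ∑ (suc (suc n)) (λ i → (ψ ^ₛ ν) i * taylor (X ^ₚ n) (i ℕ.+ 0))
      ≈⟨ ∑-single (m≤n⇒m≤1+n ≤-refl) (λ i i≢n → trans (*-congˡ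
           (·ℕ-zeroʳ ((i ℕ.+ 0) !) (coeff-X^-off-diagonal n (i ℕ.+ 0)
             (λ n≡i → i≢n (≡.sym (≡.trans n≡i (ℕₚ.+-identityʳ i))))))) (zeroʳ _)) ⟩
    (ψ ^ₛ ν) n * taylor (X ^ₚ n) (n ℕ.+ 0)
      ≡⟨ ≡.cong (λ m → (ψ ^ₛ ν) n * taylor (X ^ₚ n) m) (ℕₚ.+-identityʳ n) ⟩
    (ψ ^ₛ ν) n * taylor (X ^ₚ n) n
      ≈⟨ *-congˡ (×-congʳ (n !) (coeff-X^-diagonal n)) ⟩
    (ψ ^ₛ ν) n * ((n !) ·ℕ 1#) ∎

  ∑-X^ : ∀ {N u} k → VanishesFrom N u → ∑ N (λ i → coeff (X ^ₚ i) k * u i) ≈ u k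
  ∑-X^ {N} {u} k v = begin
    ∑ N (λ i → coeff (X ^ₚ i) k * u i)
      -- `k` may lie beyond `N`, so the sum is first prolonged to contain the index k.
      ≈⟨ ∑-truncate (m≤m+n N (suc k)) (λ i N≤i → trans (*-congˡ (v i N≤i)) (zeroʳ _)) ⟨
    ∑ (N ℕ.+ suc k) (λ i → coeff (X ^ₚ i) k * u i)
      ≈⟨ ∑-single (m≤n+m (suc k) N)
           (λ i i≢k → trans (*-congʳ (coeff-X^-off-diagonal i k i≢k)) (zeroˡ _)) ⟩
    coeff (X ^ₚ k) k * u k
      ≈⟨ trans (*-congʳ (coeff-X^-diagonal k)) (*-identityˡ _) ⟩
    u k ∎

  ∑₁-X^ : ∀ {u w : ℕ → Carrier} {n} → u 0 ≈ 0# → VanishesFrom (suc n) u → (∀ ν → w ν ≈ u ν) →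
          ∀ k → coeff (∑₁ n (λ ν → X ^ₚ ν *ₚ const (w ν))) k ≈ u k
  ∑₁-X^ {u} {w} {n} u₀≈0 v w≈u k = begin
    coeff (∑₁ n (λ ν → X ^ₚ ν *ₚ const (w ν))) k
      ≈⟨ coeff-sumₚ n (λ i → X ^ₚ suc i *ₚ const (w (suc i))) k ⟩
    ∑ n (λ i → coeff (X ^ₚ suc i *ₚ const (w (suc i))) k)
      ≈⟨ ∑-cong n (λ i _ → trans (coeff-*ₚ-const (X ^ₚ suc i) _ k) (*-congˡ (w≈u (suc i)))) ⟩
    ∑ n (λ i → coeff (X ^ₚ suc i) k * u (suc i))
      -- The term ν = 0, absent from `∑₁`, is restored at no cost since `u 0` vanishes.
      ≈⟨ trans (+-congʳ (trans (*-congˡ u₀≈0) (zeroʳ _))) (+-identityˡ _) ⟨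
    coeff (X ^ₚ 0) k * u 0 + ∑ n (λ i → coeff (X ^ₚ suc i) k * u (suc i))
      ≈⟨ ∑-suc n _ ⟨
    ∑ (suc n) (λ i → coeff (X ^ₚ i) k * u i)
      ≈⟨ ∑-X^ k v ⟩
    u k ∎

  -- Polynomials in z with coefficients in K[x].

  module Iterated = Polynomial (Polynomial.rawRing (CommutativeRing.rawRing R))

  -- Computing with constants in K[x] yields only lists of length at most one,
  -- so polynomials in z with such coefficients reduce to those over K by
  -- parametricity, without the ring laws of K[x].
  data IsConstant : Poly → Carrier → Set (c ⊔ ℓ) where
    empty     : ∀ {a} → a ≈ 0# → IsConstant [] a
    singleton : ∀ {a b} → b ≈ a → IsConstant (b ∷ []) a

  isConstant-+ : ∀ {p q a b} → IsConstant p a → IsConstant q b → IsConstant (p +ₚ q) (a + b)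
  isConstant-+ (empty a≈0)     (empty b≈0)     = empty (trans (+-cong a≈0 b≈0) (+-identityˡ _))
  isConstant-+ (empty a≈0)     (singleton y≈b) =
    singleton (trans y≈b (sym (trans (+-congʳ a≈0) (+-identityˡ _))))
  isConstant-+ (singleton x≈a) (empty b≈0)     =
    singleton (trans x≈a (sym (trans (+-congˡ b≈0) (+-identityʳ _))))
  isConstant-+ (singleton x≈a) (singleton y≈b) = singleton (+-cong x≈a y≈b)

  isConstant-* : ∀ {q a} b → IsConstant q a → IsConstant (const b *ₚ q) (b * a)
  -- `const b *ₚ []` computes to `0# ∷ []`, a zero written with length one.
  isConstant-* b (empty a≈0)     = singleton (sym (trans (*-congˡ a≈0) (zeroʳ b)))
  isConstant-* b (singleton x≈a) = singleton (trans (+-identityʳ _) (*-congˡ x≈a))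

  isConstant-·ℕ : ∀ {p a} n → IsConstant p a → IsConstant (n Iterated.·ℕ p) (n ·ℕ a)
  isConstant-·ℕ zero    _ = empty refl
  isConstant-·ℕ (suc n) h = isConstant-+ h (isConstant-·ℕ n h)

  -- `Pointwise` forces equal lengths, so the sums in `_⟨_⟩` are cut at the same place over K and
  -- over K[x].
  IsLift : Iterated.Poly → Poly → Set (c ⊔ ℓ)
  IsLift = Pointwise IsConstant

  isLift-lift : ∀ q → IsLift (map const q) q
  isLift-lift []      = []
  isLift-lift (a ∷ q) = singleton refl ∷ isLift-lift q

  isLift-+ : ∀ {P Q p q} → IsLift P p → IsLift Q q → IsLift (P Iterated.+ₚ Q) (p +ₚ q)
  isLift-+ []       h′         = h′
  isLift-+ (h ∷ hs) []         = h ∷ hs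
  isLift-+ (h ∷ hs) (h′ ∷ hs′) = isConstant-+ h h′ ∷ isLift-+ hs hs′

  isLift-· : ∀ {P p} b → IsLift P p → IsLift (const b Iterated.·ₚ P) (b ·ₚ p)
  isLift-· b []       = []
  isLift-· b (h ∷ hs) = isConstant-* b h ∷ isLift-· b hs

  isLift-sum : ∀ {m n} {F : ℕ → Iterated.Poly} {f : ℕ → Poly} → m ≡ n → (∀ i → IsLift (F i) (f i)) →
               IsLift (Iterated.sumₚ {m} (λ i → F (toℕ i))) (sumₚ {n} (λ i → f (toℕ i)))
  isLift-sum {m = zero}  ≡.refl h = []
  isLift-sum {m = suc m} ≡.refl h = isLift-+ (h 0) (isLift-sum {m = m} ≡.refl (h ∘ suc))

  isLift-diffFrom : ∀ {P p} j → IsLift P p → IsLift (Iterated.diffFrom j P) (diffFrom j p)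
  isLift-diffFrom j []       = []
  isLift-diffFrom j (h ∷ hs) = isConstant-·ℕ j h ∷ isLift-diffFrom (suc j) hs

  PreservesLift : (Iterated.Poly → Iterated.Poly) → (Poly → Poly) → Set (c ⊔ ℓ)
  PreservesLift T t = ∀ {P p} → IsLift P p → IsLift (T P) (t p)

  isLift-D : PreservesLift Iterated.D D
  isLift-D []       = []
  isLift-D (h ∷ hs) = isLift-diffFrom 1 hs

  isLift-^ᵒ : ∀ {T t} → PreservesLift T t → ∀ ν → PreservesLift (T Iterated.^ᵒ ν) (t ^ᵒ ν)
  isLift-^ᵒ pres zero    h = h
  isLift-^ᵒ pres (suc ν) h = pres (isLift-^ᵒ pres ν h)

  isLift-⟨⟩ : ∀ {T t} f → PreservesLift T t →
              PreservesLift ((λ ν → const (f ν)) Iterated.⟨ T ⟩) (f ⟨ t ⟩)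
  isLift-⟨⟩ f pres h =
    isLift-sum (Pointwise-length h) (λ i → isLift-· (f i) (isLift-^ᵒ pres i h))

  -- The value at z = 0, as the sequence of its coefficients in x.
  coeff₀ : Iterated.Poly → Series
  coeff₀ P = coeff (Iterated.coeff P 0)

  coeff₀-|₀ : ∀ P k → coeff (P Iterated.|₀) k ≈ coeff₀ P k
  coeff₀-|₀ []      k = refl
  coeff₀-|₀ (a ∷ P) k = trans (coeff-+ₚ a [] k) (+-identityʳ _)

  coeff₀-+ : ∀ P Q k → coeff₀ (P Iterated.+ₚ Q) k ≈ coeff₀ P k + coeff₀ Q k
  coeff₀-+ []      Q       k = sym (+-identityˡ _)
  coeff₀-+ (a ∷ P) []      k = sym (+-identityʳ _)
  coeff₀-+ (a ∷ P) (b ∷ Q) k = coeff-+ₚ a b k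

  coeff₀-sum : ∀ n (F : ℕ → Iterated.Poly) k →
               coeff₀ (Iterated.sumₚ {n} (λ i → F (toℕ i))) k ≈ ∑ n (λ i → coeff₀ (F i) k)
  coeff₀-sum zero    F k = sym (∑-empty _)
  coeff₀-sum (suc n) F k = trans (coeff₀-+ (F 0) _ k)
    (trans (+-congˡ (coeff₀-sum n (F ∘ suc) k)) (sym (∑-suc n _)))

  -- `a` may involve x, but the constant term of `P` in z is a constant of K, so multiplying by it
  -- only scales the coefficients of `a`.
  coeff₀-· : ∀ {P p} a k → IsLift P p → coeff₀ (a Iterated.·ₚ P) k ≈ coeff a k * p |₀
  coeff₀-· {p = p} a k h = trans (go h) (*-congˡ (sym (|₀≈coeff p)))
    where
    go : ∀ {P p} → IsLift P p → coeff₀ (a Iterated.·ₚ P) k ≈ coeff a k * coeff p 0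
    go []                   = sym (zeroʳ _)
    go (empty b≈0 ∷ _)     = trans (coeff-*ₚ-[] a k) (sym (trans (*-congˡ b≈0) (zeroʳ _)))
    go (singleton y≈b ∷ _) = trans (coeff-*ₚ-const a _ k) (*-congˡ y≈b)

  -- Separates x from z: the iterates of `T` keep the coefficients of the lifted polynomial
  -- constant, and x enters through the `F i` alone.
  coeff-lifted-⟨⟩|₀ : ∀ {T t} → PreservesLift T t → ∀ F q k →
    coeff ((F Iterated.⟨ T ⟩) (map const q) Iterated.|₀) k ≈
    ∑ (length q) (λ i → coeff (F i) k * (t ^ᵒ i) q |₀)
  coeff-lifted-⟨⟩|₀ {T} {t} pres F q k = begin
    coeff ((F Iterated.⟨ T ⟩) Q Iterated.|₀) k
      ≈⟨ coeff₀-|₀ ((F Iterated.⟨ T ⟩) Q) k ⟩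
    coeff₀ ((F Iterated.⟨ T ⟩) Q) k
      ≈⟨ coeff₀-sum (length Q) (λ i → F i Iterated.·ₚ (T Iterated.^ᵒ i) Q) k ⟩
    ∑ (length Q) (λ i → coeff₀ (F i Iterated.·ₚ (T Iterated.^ᵒ i) Q) k)
      ≡⟨ ≡.cong (λ n → ∑ n (λ i → coeff₀ (F i Iterated.·ₚ (T Iterated.^ᵒ i) Q) k))
           (length-map const q) ⟩
    ∑ (length q) (λ i → coeff₀ (F i Iterated.·ₚ (T Iterated.^ᵒ i) Q) k)
      ≈⟨ ∑-cong (length q) (λ i _ → coeff₀-· (F i) k (isLift-^ᵒ pres i (isLift-lift q))) ⟩
    ∑ (length q) (λ i → coeff (F i) k * (t ^ᵒ i) q |₀) ∎
    where Q = map const q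

module _ {c ℓ₁ ℓ₂} (F : HeytingField c ℓ₁ ℓ₂) (char0 : CharacteristicZero F) where

  private R = fieldRing F

  open Setting F char0
  open K[x]
  open CommutativeRing R hiding (zero)
  open SetoidReasoning setoid
  open CommutativeSemigroupProperties *-commutativeSemigroup using (xy∙z≈xz∙y)
  open SemiringMult semiring using (×-congʳ; ×-assocˡ; ×-comm-*; ×-assoc-*)

  -- Division by factorials.

  x*n!/n!≈x : ∀ n x → (x * ((n !) ·ℕ 1#)) * 1/ n ! ≈ x
  x*n!/n!≈x n x = trans (*-assoc _ _ _) (trans (*-congˡ (1/ν!-inverse n)) (*-identityʳ x))

  x/n!*n!≈x : ∀ n x → (x * 1/ n !) * ((n !) ·ℕ 1#) ≈ x
  x/n!*n!≈x n x =
    trans (*-assoc _ _ _) (trans (*-congˡ (trans (*-comm _ _) (1/ν!-inverse n))) (*-identityʳ x))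

  n!·x/n!≈x : ∀ n x → ((n !) ·ℕ x) / n ! ≈ x
  n!·x/n!≈x n x = trans
    (*-congʳ (trans (×-congʳ (n !) (sym (*-identityʳ x))) (sym (×-comm-* (n !) x 1#))))
    (x*n!/n!≈x n x)

  -- Multiplication by n!/n! produces (n+1) n! = (n+1)!, which cancels against `1/ suc n !`.
  suc·x/suc!≈x/n! : ∀ n x → (suc n ·ℕ x) / suc n ! ≈ x / n !
  suc·x/suc!≈x/n! n x = begin
    (suc n ·ℕ x) * w                     ≈⟨ x/n!*n!≈x n _ ⟨
    (((suc n ·ℕ x) * w) * v) * n!        ≈⟨ xy∙z≈xz∙y _ v n! ⟩
    (((suc n ·ℕ x) * w) * n!) * v        ≈⟨ *-congʳ (xy∙z≈xz∙y _ w n!) ⟩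
    (((suc n ·ℕ x) * n!) * w) * v        ≈⟨ *-congʳ (*-congʳ shuffle) ⟩
    ((x * ((suc n !) ·ℕ 1#)) * w) * v    ≈⟨ *-congʳ (x*n!/n!≈x (suc n) x) ⟩
    x * v                                ∎
    where
    v = 1/ n !
    w = 1/ suc n !
    n! = (n !) ·ℕ 1#
    shuffle : (suc n ·ℕ x) * n! ≈ x * ((suc n !) ·ℕ 1#)
    shuffle = begin
      (suc n ·ℕ x) * n!           ≈⟨ ×-assoc-* (suc n) x n! ⟩
      suc n ·ℕ (x * n!)           ≈⟨ ×-comm-* (suc n) x n! ⟨
      x * (suc n ·ℕ n!)           ≈⟨ *-congˡ (×-assocˡ 1# (suc n) (n !)) ⟩
      x * ((suc n !) ·ℕ 1#)       ∎

  -- Taylor sequences of the poweroids.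

  module _ {φ ψ : Series} (isDelta : IsDelta φ) (isInverse : IsCompositionalInverse φ ψ)
           {p : ℕ → Poly} (isPoweroids : IsPoweroids φ p) where

    open IsDelta isDelta
    open IsCompositionalInverse isInverse
    open IsPoweroids isPoweroids

    taylor-θ : ∀ n k → act R (length (p (suc n))) φ (taylor R (p (suc n))) k ≈
                       suc n ·ℕ taylor R (p n) k
    taylor-θ n k = begin
      act R (length (p (suc n))) φ (taylor R (p (suc n))) k  ≈⟨ taylor-⟨D⟩ R φ (p (suc n)) k ⟨
      taylor R ((φ ⟨ D ⟩) (p (suc n))) k                     ≈⟨ taylor-cong R ((φ ⟨ D ⟩) (p (suc n))) (suc n ·ℕₚ p n) (θpₙ≈npₙ₋₁ n) k ⟩
      taylor R (suc n ·ℕₚ p n) k                             ≈⟨ taylor-·ℕₚ R (suc n) (p n) k ⟩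
      suc n ·ℕ taylor R (p n) k                              ∎

    -- The defining equations bound degrees only indirectly: by induction θ `p (suc n)` has degree
    -- at most n, and `act-delta-degree` says that θ lowers the degree by no more than one.
    poweroid-degree : ∀ n → VanishesFrom R (suc n) (taylor R (p n))
    poweroid-degree zero    = taylor-vanishes R (p 0) λ { (suc k) _ → p₀≈1 (suc k) ; zero () }
    poweroid-degree (suc n) = act-delta-degree R isDelta (taylor-beyond-length R (p (suc n)))
      (λ k n<k → trans (taylor-θ n k) (·ℕ-zeroʳ R (suc n) (poweroid-degree n k n<k)))

    poweroid-at-0 : ∀ n → taylor R (p n) 0 / n ! ≈ 1ₛ n
    poweroid-at-0 zero    = trans (*-congʳ (×-congʳ 1 (p₀≈1 0))) (1/ν!-inverse 0)
    poweroid-at-0 (suc n) =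
      trans (*-congʳ (trans (taylor-0 R (p (suc n))) (pₙ|₀≈0 n))) (zeroˡ _)

    -- Dividing by the factorial absorbs the factor n + 1 of the defining equation.
    θ-lowers : ∀ n k → act R (suc (suc n)) φ (λ i → taylor R (p (suc n)) i / suc n !) k ≈
                       taylor R (p n) k / n !
    θ-lowers n k = begin
      ∑ R (suc (suc n)) (λ i → φ i * (taylor R (p (suc n)) (i ℕ.+ k) / suc n !))
        ≈⟨ ∑-cong R (suc (suc n)) (λ i _ → sym (*-assoc _ _ _)) ⟩
      ∑ R (suc (suc n)) (λ i → φ i * taylor R (p (suc n)) (i ℕ.+ k) / suc n !)
        ≈⟨ *-distribʳ-∑ R (suc (suc n)) _ _ ⟨
      act R (suc (suc n)) φ (taylor R (p (suc n))) k / suc n !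
        -- `taylor-θ` carries the list length as its bound; the degree bound is exchanged for it.
        ≈⟨ *-congʳ (act-bound-irrelevant R φ k (poweroid-degree (suc n))
             (taylor-beyond-length R (p (suc n)))) ⟩
      act R (length (p (suc n))) φ (taylor R (p (suc n))) k / suc n !
        ≈⟨ *-congʳ (taylor-θ n k) ⟩
      (suc n ·ℕ taylor R (p n) k) / suc n !
        ≈⟨ suc·x/suc!≈x/n! n _ ⟩
      taylor R (p n) k / n ! ∎

    taylor-poweroid : ∀ n ν → taylor R (p n) ν ≈ (ψ ^ₛ ν) n * ((n !) ·ℕ 1#)
    taylor-poweroid n ν = trans (sym (x/n!*n!≈x n _)) (*-congʳ
      (a≈ψ^ R φ₀≈0 ψ∘φ≈t (λ n k → taylor R (p n) k / n !)
        (λ n k n<k → trans (*-congʳ (poweroid-degree n k n<k)) (zeroˡ _))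
        poweroid-at-0 θ-lowers ν n))

    -- Both are n! times the coefficient of tⁿ in ψ(t)^ν.
    D^poweroid|₀≈η^X^|₀ : ∀ n ν → taylor R (p n) ν ≈ ((ψ ⟨ D ⟩) ^ᵒ ν) (X ^ₚ n) |₀
    D^poweroid|₀≈η^X^|₀ n ν = trans (taylor-poweroid n ν) (sym (⟨D⟩^X^|₀ R ψ n ν))

  -- Serves both exponentials, with t = D on the poweroid and t = η on xⁿ. The vanishing of `u` from
  -- `length q` on ensures that the cut of the exponential series omits no nonzero term.
  coeff-e^ : ∀ {T t} → PreservesLift R T t → ∀ {u} q → VanishesFrom R (length q) u →
             (∀ ν → (t ^ᵒ ν) q |₀ / ν ! ≈ u ν) →
             ∀ k → coeff ((e^xt K[x][z].⟨ T ⟩) (liftPoly q) K[x][z].|₀) k ≈ u k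
  coeff-e^ {T} {t} pres {u} q v t^q≈u k = begin
    coeff ((e^xt K[x][z].⟨ T ⟩) (liftPoly q) K[x][z].|₀) k
      ≈⟨ coeff-lifted-⟨⟩|₀ R pres e^xt q k ⟩
    ∑ R (length q) (λ i → coeff (e^xt i) k * (t ^ᵒ i) q |₀)
      ≈⟨ ∑-cong R (length q) (λ i _ → term i) ⟩
    ∑ R (length q) (λ i → coeff (X ^ₚ i) k * u i)
      ≈⟨ ∑-X^ R k v ⟩
    u k ∎
    where
    term : ∀ i → coeff (e^xt i) k * (t ^ᵒ i) q |₀ ≈ coeff (X ^ₚ i) k * u i
    term i = begin
      coeff (e^xt i) k * (t ^ᵒ i) q |₀
        ≈⟨ *-congʳ (coeff-*ₚ-const R (X ^ₚ i) (1# / i !) k) ⟩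
      (coeff (X ^ₚ i) k * (1# / i !)) * (t ^ᵒ i) q |₀
        ≈⟨ trans (*-congʳ (*-congˡ (*-identityˡ _))) (*-assoc _ _ _) ⟩
      coeff (X ^ₚ i) k * (1/ i ! * (t ^ᵒ i) q |₀)
        ≈⟨ *-congˡ (trans (*-comm _ _) (t^q≈u i)) ⟩
      coeff (X ^ₚ i) k * u i ∎

-- Comparison of coefficients.

mainTheorem3 : ∀ {c ℓ₁ ℓ₂} (F : HeytingField c ℓ₁ ℓ₂) (char0 : CharacteristicZero F) →
    let open Setting F char0
        open K[x]
    in
    (φ φ⁻¹ : Series) → IsDelta φ → IsCompositionalInverse φ φ⁻¹ →
    (p : ℕ → Poly) → IsPoweroids φ p →
    (n : ℕ) → 1 ≤ n →
    let η       = φ⁻¹ ⟨ D ⟩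
        sumD    = ∑₁ n (λ ν → X ^ₚ ν *ₚ const (((D ^ᵒ ν) (p n)) |₀ / ν !))
        sumη    = ∑₁ n (λ ν → X ^ₚ ν *ₚ const (((η ^ᵒ ν) (X ^ₚ n)) |₀ / ν !))
        exp-xD  = e^xD (p n) |₀
        exp-xη  = e^x[ φ⁻¹ ⟨D⟩] (X ^ₚ n) |₀
    in (p n ≈ₚ sumD) × (sumD ≈ₚ sumη) × (sumη ≈ₚ exp-xD) × (exp-xD ≈ₚ exp-xη)
mainTheorem3 F char0 φ ψ isDelta isInverse p isPoweroids (suc n) _ =
    (λ k → trans (p≈u k) (sym (sumD≈u k)))
  , (λ k → trans (sumD≈u k) (sym (sumη≈u k)))
  , (λ k → trans (sumη≈u k) (sym (exp-xD≈u k)))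
  , (λ k → trans (exp-xD≈u k) (sym (exp-xη≈u k)))
  where
  open Setting F char0
  open K[x]
  R = fieldRing F
  open CommutativeRing R hiding (zero)
  open IsPoweroids isPoweroids
  N = suc n
  -- The coefficient sequence shared by all five polynomials, with u ν = (D^ν `p N`)|₀ / ν!.
  u : ℕ → Carrier
  u ν = taylor R (p N) ν / ν !
  -- Here n ≥ 1 enters: it is what allows the sums to start at ν = 1.
  u₀≈0 : u 0 ≈ 0#
  u₀≈0 = trans (*-congʳ (trans (taylor-0 R (p N)) (pₙ|₀≈0 n))) (zeroˡ _)
  vanishes-/! : ∀ {m} → VanishesFrom R m (taylor R (p N)) → VanishesFrom R m u
  vanishes-/! v k m≤k = trans (*-congʳ (v k m≤k)) (zeroˡ _)
  u-vanishes : VanishesFrom R (suc N) u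
  u-vanishes = vanishes-/! (poweroid-degree F char0 isDelta isInverse isPoweroids N)
  D≈u : ∀ ν → (D ^ᵒ ν) (p N) |₀ / ν ! ≈ u ν
  D≈u ν = *-congʳ (D^|₀≈taylor R (p N) ν)
  η≈u : ∀ ν → ((ψ ⟨ D ⟩) ^ᵒ ν) (X ^ₚ N) |₀ / ν ! ≈ u ν
  η≈u ν = *-congʳ (sym (D^poweroid|₀≈η^X^|₀ F char0 isDelta isInverse isPoweroids N ν))
  -- Dividing by k! undoes the factor k! in `taylor`.
  p≈u : ∀ k → coeff (p N) k ≈ u k
  p≈u k = sym (n!·x/n!≈x F char0 k _)
  sumD≈u = ∑₁-X^ R u₀≈0 u-vanishes D≈u
  sumη≈u = ∑₁-X^ R u₀≈0 u-vanishes η≈u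
  -- The vanishing bound must be the length of the list acted on: for `p N` it holds as for any
  -- list, for `X ^ₚ N` it follows from the degree of `p N` and `length-X^`.
  exp-xD≈u = coeff-e^ F char0 (isLift-D R) (p N) (vanishes-/! (taylor-beyond-length R (p N))) D≈u
  exp-xη≈u = coeff-e^ F char0 (isLift-⟨⟩ R ψ (isLift-D R)) (X ^ₚ N)
    (vanishes-mono R (length-X^ R N) u-vanishes) η≈u
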